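{- There exists a deterministic two-party protocol for $(2\Delta)$-edge coloring that uses no communication: from $V$, $\Delta$ and her own edge set $E_A$ alone Alice computes a coloring of $E_A$, and from $V$, $\Delta$ and his own edge set $E_B$ alone Bob computes a coloring of $E_B$, both with colors from a common set of $2\Delta$ colors, such that for every graph $G=(V,E_A\sqcup E_B)$ with maximum degree $\Delta$ the combined coloring is a proper edge coloring of $G$.
   Context: Two-party edge-partition model: $G=(V,E)$ is a finite simple undirected graph with $n$ vertices and maximum degree $\Delta$. The vertex set $V$ and the numbers $n,\Delta$ are known to both parties. The edge set is partitioned adversarially as $E=E_A\sqcup E_B$; Alice receives $E_A$, Bob receives $E_B$. Each party outputs the colors of its own edges only. An edge coloring is proper if any two edges sharing an endpoint receive different colors. -}

module Defs where

open import Data.Empty using (⊥-elim-irr)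
open import Data.Fin.Base using (Fin)
open import Data.Fin.Subset using (Subset; _∈_; ∣_∣)
open import Data.Fin.Subset.Properties using (_∈?_; p⊆q⇒∣p∣≤∣q∣)
open import Data.List.Base using (map; allFin)
open import Data.List.Extrema.Nat using (max; max≤v⁺; xs≤max)
open import Data.List.Membership.Propositional.Properties using (∈-allFin)
open import Data.List.Relation.Unary.All as All using ()
open import Data.List.Relation.Unary.All.Properties using (map⁺; map⁻)
open import Data.Nat.Base using (ℕ; _≤_; z≤n)
open import Data.Nat.Properties using (≤-trans)
open import Data.Product.Base using (_×_; _,_)
open import Data.Sum.Base using (_⊎_; inj₁; inj₂)
open import Data.Vec.Base using (Vec; lookup)
open import Function.Bundles using (_⇔_; module Equivalence)
open import Relation.Binary.PropositionalEquality using (_≡_; _≢_; subst)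
open import Relation.Nullary using (¬_)
open import Relation.Nullary.Decidable using (recompute)
open import Relation.Nullary.Negation using (contradiction)

-- A simple graph on the vertex set Fin n, given by its neighbourhoods.  The
-- laws are irrelevant, so a graph carries no data beyond its set of edges.
record Graph (n : ℕ) : Set where
  constructor mkGraph
  field
    nbrs     : Vec (Subset n) n
    .symm    : ∀ u v → v ∈ lookup nbrs u → u ∈ lookup nbrs v
    .irrefl  : ∀ v → ¬ (v ∈ lookup nbrs v)

open Graph public using (nbrs)

Adj : ∀ {n} → Graph n → Fin n → Fin n → Set
Adj G u v = v ∈ lookup (nbrs G) u

adj-sym : ∀ {n} (G : Graph n) u v → Adj G u v → Adj G v u
adj-sym (mkGraph N s _) u v e = recompute (u ∈? lookup N v) (s u v e)

adj-irrefl : ∀ {n} (G : Graph n) v → ¬ Adj G v v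
adj-irrefl (mkGraph N _ i) v e = ⊥-elim-irr (i v e)

degree : ∀ {n} → Graph n → Fin n → ℕ
degree G v = ∣ lookup (nbrs G) v ∣

-- Equal to 0 on the empty vertex set.
maxDegree : ∀ {n} → Graph n → ℕ
maxDegree {n} G = max 0 (map (degree G) (allFin n))

-- A colour for every edge.  An edge occurs here in both orientations (and
-- with its adjacency proof); agree makes the colour depend on neither.
record EdgeColoring {n} (G : Graph n) (k : ℕ) : Set where
  field
    color : ∀ u v → Adj G u v → Fin k
    agree : ∀ u v (e : Adj G u v) (e′ : Adj G v u) → color u v e ≡ color v u e′

open EdgeColoring public

Proper : ∀ {n} {G : Graph n} {k} → EdgeColoring G k → Set
Proper {G = G} c = ∀ u v w (e : Adj G u v) (f : Adj G u w) →
                   v ≢ w → color c u v e ≢ color c u w f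

-- The edge set of G is the disjoint union of those of A and B.
record Partition {n} (G A B : Graph n) : Set where
  field
    cover    : ∀ u v → Adj G u v ⇔ (Adj A u v ⊎ Adj B u v)
    disjoint : ∀ u v → ¬ (Adj A u v × Adj B u v)

open Partition public

-- A party's side of a protocol without communication, with palette Δ colours
-- available when the maximum degree of the whole graph is Δ.  A party only
-- receives edge sets of maximum degree at most Δ, as parts of such a graph.
LocalAlgorithm : (ℕ → ℕ) → Set
LocalAlgorithm palette =
  ∀ n Δ (E : Graph n) → .(maxDegree E ≤ Δ) → EdgeColoring E (palette Δ)

maxDegree-mono : ∀ {n} (H G : Graph n) →
                 (∀ u v → Adj H u v → Adj G u v) → maxDegree H ≤ maxDegree G
maxDegree-mono {n} H G H⊆G = max≤v⁺ z≤n (map⁺ {xs = allFin n} (All.tabulate λ {u} _ →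
  ≤-trans (p⊆q⇒∣p∣≤∣q∣ (λ {v} → H⊆G u v))
          (All.lookup (map⁻ (xs≤max 0 (map (degree G) (allFin n)))) (∈-allFin u))))

module _ {n} {G A B : Graph n} (p : Partition G A B) where

  partˡ-≤ : ∀ {Δ} → maxDegree G ≡ Δ → maxDegree A ≤ Δ
  partˡ-≤ eq = subst (maxDegree A ≤_) eq
    (maxDegree-mono A G λ u v e → Equivalence.from (cover p u v) (inj₁ e))

  partʳ-≤ : ∀ {Δ} → maxDegree G ≡ Δ → maxDegree B ≤ Δ
  partʳ-≤ eq = subst (maxDegree B ≤_) eq
    (maxDegree-mono B G λ u v e → Equivalence.from (cover p u v) (inj₂ e))

  module _ {k} (a : EdgeColoring A k) (b : EdgeColoring B k) where

    pick : ∀ u v → Adj A u v ⊎ Adj B u v → Fin k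
    pick u v (inj₁ e) = color a u v e
    pick u v (inj₂ e) = color b u v e

    pick-agree : ∀ u v x y → pick u v x ≡ pick v u y
    pick-agree u v (inj₁ e) (inj₁ f) = agree a u v e f
    pick-agree u v (inj₂ e) (inj₂ f) = agree b u v e f
    pick-agree u v (inj₁ e) (inj₂ f) =
      contradiction (e , adj-sym B v u f) (disjoint p u v)
    pick-agree u v (inj₂ e) (inj₁ f) =
      contradiction (adj-sym A v u f , e) (disjoint p u v)

    combine : EdgeColoring G k
    combine .color u v e = pick u v (Equivalence.to (cover p u v) e)
    combine .agree u v e f = pick-agree u v (Equivalence.to (cover p u v) e)
                                            (Equivalence.to (cover p v u) f)

{-# OPTIONS --safe #-}
-- Of the 2Δ colours each party owns Δ.  A party that sees degree Δ at a vertex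
-- knows that the other party has no edge there, so a matching between vertices
-- of degree Δ may be given a colour owned by the other party.  Once a maximal
-- such matching is set aside, the vertices of degree Δ are independent in what
-- is left, which by Fournier's refinement of Vizing's theorem has a proper edge
-- colouring with the Δ own colours.

module Submission where

open import Defs
open import Data.Bool.Base using (Bool; true; false; _∨_; if_then_else_)
open import Data.Bool.Properties using (∨-zeroʳ) renaming (_≟_ to _≟ᵇ_)
open import Data.Fin.Base as Fin using (Fin; zero; suc; fromℕ<)
open import Data.Fin.Properties
  using (_≟_; any?; suc-injective; 0≢1+n; combine-injectiveˡ; combine-injectiveʳ)
open import Data.Fin.Subset using (Subset; ∣_∣; ⊤; _-_) renaming (_∈_ to _∈ₛ_)
open import Data.Fin.Subset.Properties
  using (_∈?_; ∈⊤; x∈p∧x≢y⇒x∈p-y; x∈p⇒∣p-x∣<∣p∣; p⊂q⇒∣p∣<∣q∣)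
open import Data.List.Base using (List; []; _∷_; _++_; [_]; map; allFin; cartesianProduct)
open import Data.List.Extrema.Nat using (xs≤max)
open import Data.List.Membership.Propositional using (_∈_; _∉_)
open import Data.List.Membership.Propositional.Properties
  using (∈-++⁺ˡ; ∈-++⁺ʳ; ∈-++⁻; ∈-allFin; ∈-cartesianProduct⁺)
open import Data.List.Relation.Unary.All as All using ()
open import Data.List.Relation.Unary.All.Properties using (map⁻)
open import Data.List.Relation.Unary.Any using (here; there) renaming (any? to any∈?)
open import Data.Maybe.Base using (Maybe; just; nothing; is-just)
open import Data.Maybe.Properties using (just-injective; ≡-dec)
open import Data.Maybe.Relation.Unary.All as Maybe using (just; nothing)
open import Data.Nat.Base using (ℕ; zero; suc; _*_; _<_; _≤_; z≤n; s≤s)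
open import Data.Nat.Properties
  using (<-≤-trans; ≤-<-trans; ≤-refl; ≤-trans; <⇒≱; ≰⇒>; _≤?_)
open import Data.Product.Base using (Σ; ∃; _×_; _,_; proj₁; proj₂; swap; map₂)
open import Data.Sum.Base as Sum using (_⊎_; inj₁; inj₂; [_,_]′)
open import Data.Vec.Base using (lookup)
open import Function.Base using (_∘_; id)
open import Function.Bundles using (module Equivalence)
open import Relation.Binary.PropositionalEquality
  using (_≡_; _≢_; refl; sym; trans; cong; subst)
open import Relation.Nullary using (¬_; Dec; yes; no; does)
open import Relation.Nullary.Decidable
  using (dec-true; dec-false; recompute; ¬?; _×-dec_; _⊎-dec_)
open import Relation.Nullary.Negation using (contradiction)

-- The `Δ` own colours need not suffice: a party may hold a triangle with `Δ` equal to 2, and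
-- Vizing's bound used by each party separately would cost `2Δ + 2` colours. One borrowed colour
-- closes the gap, since the edges that receive it never meet. Fournier's refinement comes from the
-- locality of Vizing's insertion of an edge: it asks for a missing colour only at the centre of the
-- fan and at the vertices that the fan may visit, and a suitable order of insertion and choice of
-- centre provide these. Alternating chains are never represented as paths: a flip is known only by
-- its support, by the colours it leaves alone and by its effect on missing colours.

-- Partial proper edge colourings and the recolouring of one edge.

record PartialColouring (n k : ℕ) : Set where
  field
    col      : Fin n → Fin n → Maybe (Fin k)
    symm     : ∀ u v → col u v ≡ col v u
    loopless : ∀ v → col v v ≡ nothing
    inj      : ∀ {u v w a} → col u v ≡ just a → col u w ≡ just a → v ≡ w

open PartialColouring

just≢nothing : ∀ {A : Set} {m : Maybe A} {a} → m ≡ just a → m ≢ nothing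
just≢nothing refl ()

is-just⇒≡just : ∀ {A : Set} {m : Maybe A} → is-just m ≡ true → ∃ λ a → m ≡ just a
is-just⇒≡just {m = just a} _ = a , refl

¬is-just⇒≡nothing : ∀ {A : Set} {m : Maybe A} → is-just m ≡ false → m ≡ nothing
¬is-just⇒≡nothing {m = nothing} _ = refl

SameEdge : ∀ {n} → (x y u v : Fin n) → Set
SameEdge x y u v = (u ≡ x × v ≡ y) ⊎ (u ≡ y × v ≡ x)

abstract
  -- Opaque, so that `does (sameEdge? x y u v)` stays one term for `with` to abstract instead of
  -- unfolding into tests of `_≟_`.
  sameEdge? : ∀ {n} (x y u v : Fin n) → Dec (SameEdge x y u v)
  sameEdge? x y u v = (u ≟ x) ×-dec (v ≟ y) ⊎-dec (u ≟ y) ×-dec (v ≟ x)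

sameEdge-sym : ∀ {n} {x y u v : Fin n} → SameEdge x y u v → SameEdge x y v u
sameEdge-sym (inj₁ (p , q)) = inj₂ (q , p)
sameEdge-sym (inj₂ (p , q)) = inj₁ (q , p)

module _ {n k : ℕ} where

  Miss : PartialColouring n k → Fin n → Fin k → Set
  Miss c u a = ∀ v → col c u v ≢ just a

  present? : ∀ c u a → (∃ λ v → col c u v ≡ just a) ⊎ Miss c u a
  present? c u a with any? (λ v → ≡-dec _≟_ (col c u v) (just a))
  ... | yes p = inj₁ p
  ... | no ¬p = inj₂ λ v e → ¬p (v , e)

  col-sym : ∀ (c : PartialColouring n k) {u v m} → col c u v ≡ m → col c v u ≡ m
  col-sym c e = trans (symm c _ _) e

  col-sameEdge : ∀ (c : PartialColouring n k) {x y u v} →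
                 SameEdge x y u v → col c u v ≡ col c x y
  col-sameEdge c (inj₁ (refl , refl)) = refl
  col-sameEdge c (inj₂ (refl , refl)) = symm c _ _

  module _ (c : PartialColouring n k) (x y : Fin n) (m : Maybe (Fin k)) where

    recolour : Fin n → Fin n → Maybe (Fin k)
    recolour u v = if does (sameEdge? x y u v) then m else col c u v

    recolour-on : ∀ {u v} → SameEdge x y u v → recolour u v ≡ m
    recolour-on {u} {v} e with sameEdge? x y u v
    ... | yes _ = refl
    ... | no ¬e = contradiction e ¬e

    recolour-off : ∀ {u v} → ¬ SameEdge x y u v → recolour u v ≡ col c u v
    recolour-off {u} {v} ¬e with sameEdge? x y u v
    ... | yes e = contradiction e ¬e
    ... | no _  = refl

    recolour-just : ∀ {u v a} → recolour u v ≡ just a →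
      (SameEdge x y u v × m ≡ just a) ⊎ (¬ SameEdge x y u v × col c u v ≡ just a)
    recolour-just {u} {v} p with sameEdge? x y u v
    ... | yes e = inj₁ (e , p)
    ... | no ¬e = inj₂ (¬e , p)

    recolour-miss-other : ∀ {u a} → Miss c u a → m ≢ just a →
                          ∀ v → recolour u v ≢ just a
    recolour-miss-other miss m≢ v p with recolour-just p
    ... | inj₁ (_ , q) = m≢ q
    ... | inj₂ (_ , q) = miss v q

    recolour-miss-away : ∀ {u a} → Miss c u a → u ≢ x → u ≢ y →
                         ∀ v → recolour u v ≢ just a
    recolour-miss-away miss u≢x u≢y v p with recolour-just p
    ... | inj₁ (inj₁ (q , _) , _) = u≢x q
    ... | inj₁ (inj₂ (q , _) , _) = u≢y q
    ... | inj₂ (_ , q) = miss v q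

    -- `Maybe.All` treats deletion and colouring at once: the condition is void for `nothing`, and
    -- for `just a` it asks that `a` be free at both ends.
    recolouring : x ≢ y → Maybe.All (λ a → Miss c x a × Miss c y a) m →
                  PartialColouring n k
    recolouring x≢y free = record
      { col = recolour ; symm = symm′ ; loopless = loopless′ ; inj = inj′ }
      where
      symm′ : ∀ u v → recolour u v ≡ recolour v u
      symm′ u v with sameEdge? x y u v
      ... | yes e = sym (recolour-on (sameEdge-sym e))
      ... | no ¬e = trans (symm c u v) (sym (recolour-off (¬e ∘ sameEdge-sym)))

      loopless′ : ∀ v → recolour v v ≡ nothing
      loopless′ v with sameEdge? x y v v
      ... | yes (inj₁ (refl , refl)) = contradiction refl x≢y
      ... | yes (inj₂ (refl , refl)) = contradiction refl x≢y
      ... | no _ = loopless c v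

      clash : ∀ {u v w a} → SameEdge x y u v → m ≡ just a → col c u w ≢ just a
      clash e eq q with subst (Maybe.All _) eq free
      clash (inj₁ (refl , _)) eq q | just (fx , _) = fx _ q
      clash (inj₂ (refl , _)) eq q | just (_ , fy) = fy _ q

      inj′ : ∀ {u v w a} → recolour u v ≡ just a → recolour u w ≡ just a → v ≡ w
      inj′ p q with recolour-just p | recolour-just q
      ... | inj₁ (inj₁ (refl , refl) , _) | inj₁ (inj₁ (_ , refl) , _) = refl
      ... | inj₁ (inj₁ (refl , refl) , _) | inj₁ (inj₂ (e , _) , _) = contradiction e x≢y
      ... | inj₁ (inj₂ (refl , refl) , _) | inj₁ (inj₁ (e , _) , _) = contradiction (sym e) x≢y
      ... | inj₁ (inj₂ (refl , refl) , _) | inj₁ (inj₂ (_ , refl) , _) = refl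
      ... | inj₁ (e , r) | inj₂ (_ , s) = contradiction s (clash e r)
      ... | inj₂ (_ , s) | inj₁ (e , r) = contradiction s (clash e r)
      ... | inj₂ (_ , r) | inj₂ (_ , s) = inj c r s

  remove : (c : PartialColouring n k) (x y : Fin n) → x ≢ y → PartialColouring n k
  remove c x y x≢y = recolouring c x y nothing x≢y nothing

  add : (c : PartialColouring n k) (x y : Fin n) (a : Fin k) → x ≢ y →
        Miss c x a → Miss c y a → PartialColouring n k
  add c x y a x≢y mx my = recolouring c x y (just a) x≢y (just (mx , my))

  edge-distinct : ∀ (c : PartialColouring n k) {x y a} → col c x y ≡ just a → x ≢ y
  edge-distinct c p refl = just≢nothing p (loopless c _)

  module _ (c : PartialColouring n k) {x y : Fin n} (x≢y : x ≢ y) where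

    remove-miss : ∀ {u a} → Miss c u a → Miss (remove c x y x≢y) u a
    remove-miss miss = recolour-miss-other c x y nothing miss λ ()

    remove-just : ∀ {u v a} → col (remove c x y x≢y) u v ≡ just a → col c u v ≡ just a
    remove-just p with recolour-just c x y nothing p
    ... | inj₂ (_ , q) = q

    remove-missˡ : ∀ {a} → col c x y ≡ just a → Miss (remove c x y x≢y) x a
    remove-missˡ p v q with recolour-just c x y nothing q
    ... | inj₂ (¬e , r) = ¬e (inj₁ (refl , inj c r p))

    remove-missʳ : ∀ {a} → col c x y ≡ just a → Miss (remove c x y x≢y) y a
    remove-missʳ p v q with recolour-just c x y nothing q
    ... | inj₂ (¬e , r) = ¬e (inj₂ (refl , inj c r (col-sym c p)))

  -- Kempe chains.

  Unchanged Swapped : (c c′ : PartialColouring n k) (a b : Fin k) → Fin n → Set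
  Unchanged c c′ a b w = (Miss c w a → Miss c′ w a) × (Miss c w b → Miss c′ w b)
  Swapped   c c′ a b w = (Miss c w a → Miss c′ w b) × (Miss c w b → Miss c′ w a)

  -- The exchange of `a` and `b` along the alternating chain from `x`. The other end of the chain is
  -- `end`, which is `x` itself if the chain has no edge. `rest` consists of implications only, so
  -- it is vacuous at interior vertices, where both colours are present.
  record Flip (c : PartialColouring n k) (x : Fin n) (a b : Fin k) : Set where
    field
      out      : PartialColouring n k
      support  : ∀ u v → is-just (col out u v) ≡ is-just (col c u v)
      keep     : ∀ {u v e} → e ≢ a → e ≢ b → col c u v ≡ just e → col out u v ≡ just e
      keep⁻    : ∀ {u v e} → e ≢ a → e ≢ b → col out u v ≡ just e → col c u v ≡ just e
      end      : Fin n
      end-x    : Miss c x b → end ≡ x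
      swap-x   : Swapped c out a b x
      swap-end : Swapped c out a b end
      rest     : ∀ {w} → w ≢ x → w ≢ end → Unchanged c out a b w

  flip-both : ∀ {c x a b w} (F : Flip c x a b) → Miss c w a → Miss c w b →
              Miss (Flip.out F) w a × Miss (Flip.out F) w b
  flip-both {x = x} {w = w} F ma mb with w ≟ x | w ≟ Flip.end F
  ... | yes refl | _ = proj₂ (Flip.swap-x F) mb , proj₁ (Flip.swap-x F) ma
  ... | no _ | yes refl = proj₂ (Flip.swap-end F) mb , proj₁ (Flip.swap-end F) ma
  ... | no w≢x | no w≢end = proj₁ (Flip.rest F w≢x w≢end) ma , proj₂ (Flip.rest F w≢x w≢end) mb

  -- The chain from x is flipped by removing its first edge x x₁ (of colour b),
  -- flipping the chain from x₁ in what is left, and putting x x₁ back with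
  -- colour a.  W bounds the vertices that the chain can still visit.
  flip′ : ∀ m (W : Subset n) → ∣ W ∣ < m → ∀ c x {a b} → a ≢ b → Miss c x a →
          (∀ {u v e} → e ≡ a ⊎ e ≡ b → col c u v ≡ just e → u ∈ₛ W) →
          Flip c x a b
  flip′ (suc m) W (s≤s ∣W∣≤m) c x {a} {b} a≢b miss-a inW with present? c x b
  ... | inj₂ miss-b = record
    { out = c ; support = λ _ _ → refl ; keep = λ _ _ p → p ; keep⁻ = λ _ _ p → p
    ; end = x ; end-x = λ _ → refl
    ; swap-x = (λ _ → miss-b) , (λ _ → miss-a)
    ; swap-end = (λ _ → miss-b) , (λ _ → miss-a)
    ; rest = λ _ _ → id , id }
  ... | inj₁ (x₁ , p) = record
    { out = c′ ; support = support′ ; keep = keep′ ; keep⁻ = keep⁻′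
    ; end = F.end ; end-x = λ mb → contradiction p (mb x₁)
    ; swap-x = swap-x′ ; swap-end = swap-end′ ; rest = rest′ }
    where
    x≢x₁ = edge-distinct c p
    c₀ = remove c x x₁ x≢x₁
    c₀-a : Miss c₀ x a
    c₀-a = remove-miss c x≢x₁ miss-a
    c₀-b : Miss c₀ x b
    c₀-b = remove-missˡ c x≢x₁ p

    -- Without `x x₁` both colours are missing at `x`, so the rest of the chain never returns to `x`
    -- and `W` shrinks.
    inW′ : ∀ {u v e} → e ≡ b ⊎ e ≡ a → col c₀ u v ≡ just e → u ∈ₛ W - x
    inW′ {u} {v} e q = x∈p∧x≢y⇒x∈p-y (inW (Sum.swap e) (remove-just c x≢x₁ q)) λ where
      refl → [ (λ { refl → c₀-b v q }) , (λ { refl → c₀-a v q }) ]′ e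

    F = flip′ m (W - x) (<-≤-trans (x∈p⇒∣p-x∣<∣p∣ (inW (inj₂ refl) p)) ∣W∣≤m)
              c₀ x₁ (a≢b ∘ sym) (remove-missʳ c x≢x₁ p) inW′
    module F = Flip F
    c₁ = F.out

    c₁-ab : Miss c₁ x a × Miss c₁ x b
    c₁-ab = swap (flip-both F c₀-b c₀-a)

    c₁-x₁ : Miss c₁ x₁ a
    c₁-x₁ = proj₁ F.swap-x (remove-missʳ c x≢x₁ p)

    c′ = add c₁ x x₁ a x≢x₁ (proj₁ c₁-ab) c₁-x₁

    other : ∀ {w} → Miss c₁ w b → Miss c′ w b
    other miss = recolour-miss-other c₁ x x₁ (just a) miss (a≢b ∘ just-injective)

    away : ∀ {w e} → w ≢ x → w ≢ x₁ → Miss c₁ w e → Miss c′ w e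
    away w≢x w≢x₁ miss = recolour-miss-away c₁ x x₁ (just a) miss w≢x w≢x₁

    support′ : ∀ u v → is-just (col c′ u v) ≡ is-just (col c u v)
    support′ u v with sameEdge? x x₁ u v in eq
    ... | yes e = cong is-just (sym (trans (col-sameEdge c e) p))
    ... | no ¬e = trans (F.support u v) (cong is-just (recolour-off c x x₁ nothing ¬e))

    keep′ : ∀ {u v e} → e ≢ a → e ≢ b → col c u v ≡ just e → col c′ u v ≡ just e
    keep′ e≢a e≢b q = trans (recolour-off c₁ x x₁ (just a) ¬same)
      (F.keep e≢b e≢a (trans (recolour-off c x x₁ nothing ¬same) q))
      where
      ¬same : ¬ SameEdge x x₁ _ _
      ¬same s = e≢b (just-injective (trans (sym q) (trans (col-sameEdge c s) p)))

    keep⁻′ : ∀ {u v e} → e ≢ a → e ≢ b → col c′ u v ≡ just e → col c u v ≡ just e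
    keep⁻′ e≢a e≢b q with recolour-just c₁ x x₁ (just a) q
    ... | inj₁ (_ , r) = contradiction (sym (just-injective r)) e≢a
    ... | inj₂ (_ , r) = remove-just c x≢x₁ (F.keep⁻ e≢b e≢a r)

    swap-x′ : Swapped c c′ a b x
    swap-x′ = (λ _ → other (proj₂ c₁-ab)) , λ mb → contradiction p (mb x₁)

    swap-x₁ : Swapped c c′ a b x₁
    swap-x₁ = (λ ma → other (proj₂ F.swap-x (remove-miss c x≢x₁ ma)))
            , λ mb → contradiction (col-sym c p) (mb x)

    swap-end′ : Swapped c c′ a b F.end
    swap-end′ with F.end ≟ x | F.end ≟ x₁
    ... | yes e | _ = subst (Swapped c c′ a b) (sym e) swap-x′
    ... | no _ | yes e = subst (Swapped c c′ a b) (sym e) swap-x₁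
    ... | no e≢x | no e≢x₁ =
      (λ ma → away e≢x e≢x₁ (proj₂ F.swap-end (remove-miss c x≢x₁ ma)))
      , λ mb → away e≢x e≢x₁ (proj₁ F.swap-end (remove-miss c x≢x₁ mb))

    rest′ : ∀ {w} → w ≢ x → w ≢ F.end → Unchanged c c′ a b w
    rest′ {w} w≢x w≢end with w ≟ x₁
    -- If `x₁` lacked `a`, the inner chain would have no edge and `x₁` would be its end.
    ... | yes refl = (λ ma → contradiction (sym (F.end-x (remove-miss c x≢x₁ ma))) w≢end)
                   , λ mb → contradiction (col-sym c p) (mb x)
    ... | no w≢x₁ =
      (λ ma → away w≢x w≢x₁ (proj₂ (F.rest w≢x₁ w≢end) (remove-miss c x≢x₁ ma)))
      , λ mb → away w≢x w≢x₁ (proj₁ (F.rest w≢x₁ w≢end) (remove-miss c x≢x₁ mb))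

  flip : ∀ c x {a b} → a ≢ b → Miss c x a → Flip c x a b
  flip c x a≢b miss = flip′ (suc ∣ ⊤ {n} ∣) ⊤ (s≤s ≤-refl) c x a≢b miss λ _ _ → ∈⊤

  -- Vizing fans and the insertion of one edge.

  -- Vizing fan at x.  The edge from x to the first vertex y of the fan is
  -- meant to be uncoloured; w is the last vertex.
  data Fan (c : PartialColouring n k) (x : Fin n) : Fin n → List (Fin n) → Fin n → Set where
    stop : ∀ {y} → Fan c x y [] y
    step : ∀ {y y′ ys w a} → col c x y′ ≡ just a → Miss c y a → y ∉ y′ ∷ ys →
           Fan c x y′ ys w → Fan c x y (y′ ∷ ys) w

  fan-head∉ : ∀ {c x y ys w} → Fan c x y ys w → y ∉ ys
  fan-head∉ stop = λ ()
  fan-head∉ (step _ _ y∉ _) = y∉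

  fan-last∈ : ∀ {c x y ys w} → Fan c x y ys w → w ∈ y ∷ ys
  fan-last∈ stop = here refl
  fan-last∈ (step _ _ _ fan) = there (fan-last∈ fan)

  fan-snoc : ∀ {c x y ys w y′ a} → Fan c x y ys w → col c x y′ ≡ just a → Miss c w a →
             y′ ∉ y ∷ ys → Fan c x y (ys ++ [ y′ ]) y′
  fan-snoc stop p m y′∉ = step p m (λ { (here refl) → y′∉ (here refl) }) stop
  fan-snoc {ys = ys} (step q m′ y∉ fan) p m y′∉ =
    step q m′ y∉′ (fan-snoc fan p m (y′∉ ∘ there))
    where
    y∉′ : _ ∉ ys ++ [ _ ]
    y∉′ y∈ with ∈-++⁻ ys y∈
    ... | inj₁ y∈ys = y∉ y∈ys
    ... | inj₂ (here refl) = y′∉ (here refl)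

  fan-map : ∀ {c c′ x y ys w} →
    (∀ {v a} → v ∈ ys → col c x v ≡ just a →
       col c′ x v ≡ just a × (∀ {u} → u ∈ y ∷ ys → Miss c u a → Miss c′ u a)) →
    Fan c x y ys w → Fan c′ x y ys w
  fan-map f stop = stop
  fan-map f (step p m y∉ fan) =
    step (proj₁ (f (here refl) p)) (proj₂ (f (here refl) p) (here refl) m) y∉
         (fan-map (λ v∈ q → map₂ (λ g u∈ → g (there u∈)) (f (there v∈) q)) fan)

  -- s is the set of edges to be coloured, x the centre of all fans.
  module _ (s : Fin n → Fin n → Bool) (x : Fin n) where

    record HoleAt (c : PartialColouring n k) (y : Fin n) : Set where
      field
        distinct : x ≢ y
        hole     : col c x y ≡ nothing
        want     : ∀ {u v} → SameEdge x y u v → s u v ≡ true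
        off      : ∀ {u v} → ¬ SameEdge x y u v → is-just (col c u v) ≡ s u v
    open HoleAt

    Completed : Set
    Completed = Σ (PartialColouring n k) λ c → ∀ u v → is-just (col c u v) ≡ s u v

    fill : ∀ {c y d} → HoleAt c y → Miss c x d → Miss c y d → Completed
    fill {c} {y} {d} h mx my = add c x y d (distinct h) mx my , full
      where
      full : ∀ u v → is-just (recolour c x y (just d) u v) ≡ s u v
      full u v with sameEdge? x y u v
      ... | yes e = sym (want h e)
      ... | no ¬e = off h ¬e

    hole-≢ : ∀ {c y y₁ a} → HoleAt c y → col c x y₁ ≡ just a → y₁ ≢ y
    hole-≢ h p refl = just≢nothing p (hole h)

    spoke-≢ : ∀ {y v} → x ≢ y → v ≢ y → ¬ SameEdge x y x v
    spoke-≢ x≢y v≢y (inj₁ (_ , e)) = v≢y e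
    spoke-≢ x≢y v≢y (inj₂ (e , _)) = x≢y e

    -- The hole passes from `x y` to `x y₁`. Taking `c₁` to be any colouring with the right support
    -- covers both the plain rotation of a fan and the rotation after a flip.
    move : ∀ {c y y₁ a b} (h : HoleAt c y) (p : col c x y₁ ≡ just a) c₁ →
           (∀ u v → is-just (col c₁ u v) ≡ is-just (col (remove c x y₁ (edge-distinct c p)) u v)) →
           (mx : Miss c₁ x b) (my : Miss c₁ y b) →
           HoleAt (add c₁ x y b (distinct h) mx my) y₁
    move {c} {y} {y₁} {b = b} h p c₁ supp mx my = record
      { distinct = edge-distinct c p ; hole = hole′ ; want = want′ ; off = off′ }
      where
      hole′ : recolour c₁ x y (just b) x y₁ ≡ nothing
      hole′ = trans (recolour-off c₁ x y (just b) (spoke-≢ (distinct h) (hole-≢ h p)))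
        (¬is-just⇒≡nothing (trans (supp x y₁)
          (cong is-just (recolour-on c x y₁ nothing (inj₁ (refl , refl))))))

      want′ : ∀ {u v} → SameEdge x y₁ u v → s u v ≡ true
      want′ {u} {v} e with sameEdge? x y u v
      ... | yes e′ = want h e′
      ... | no ¬e′ = trans (sym (off h ¬e′)) (cong is-just (trans (col-sameEdge c e) p))

      off′ : ∀ {u v} → ¬ SameEdge x y₁ u v → is-just (recolour c₁ x y (just b) u v) ≡ s u v
      off′ {u} {v} ¬e with sameEdge? x y u v
      ... | yes e′ = sym (want h e′)
      ... | no ¬e′ = 
        trans (supp u v) (trans (cong is-just (recolour-off c x y₁ nothing ¬e)) (off h ¬e′))

    module Shift {c y y₁ a} (h : HoleAt c y) (p : col c x y₁ ≡ just a) (m : Miss c y a) where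
      private
        x≢y₁ = edge-distinct c p
        c₀ = remove c x y₁ x≢y₁
        c₀-x = remove-missˡ c x≢y₁ p
        c₀-y = remove-miss c x≢y₁ m

      shifted : PartialColouring n k
      shifted = add c₀ x y a (distinct h) c₀-x c₀-y

      shifted-hole : HoleAt shifted y₁
      shifted-hole = move h p c₀ (λ _ _ → refl) c₀-x c₀-y

      -- The centre loses the colour `a` on one spoke and regains it on another, so only `y` can
      -- cease to lack a colour.
      shifted-miss : ∀ {u e} → u ≢ y → Miss c u e → Miss shifted u e
      shifted-miss {u} u≢y miss with u ≟ x
      ... | no u≢x = recolour-miss-away c₀ x y (just a) (remove-miss c x≢y₁ miss) u≢x u≢y
      ... | yes refl = recolour-miss-other c₀ x y (just a) (remove-miss c x≢y₁ miss)
                         λ { refl → miss y₁ p }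

      shifted-col : ∀ {v} → v ≢ y → v ≢ y₁ → col shifted x v ≡ col c x v
      shifted-col v≢y v≢y₁ = trans (recolour-off c₀ x y (just a) (spoke-≢ (distinct h) v≢y))
        (recolour-off c x y₁ nothing (spoke-≢ (edge-distinct c p) v≢y₁))

      shifted-fan : ∀ {ys w} → y ∉ y₁ ∷ ys → Fan c x y₁ ys w → Fan shifted x y₁ ys w
      shifted-fan y∉ fan = fan-map (λ v∈ q →
          trans (shifted-col (λ { refl → y∉ (there v∈) }) (λ { refl → fan-head∉ fan v∈ })) q
        , λ { u∈ → shifted-miss λ { refl → y∉ u∈ } }) fan

    -- Rotating the whole fan brings the hole to `x w`, where `d` is free at both ends.
    complete : ∀ {c y ys w d} → Fan c x y ys w → HoleAt c y → Miss c x d → Miss c w d → Completed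
    complete stop h mx mw = fill h mx mw
    complete (step p m y∉ fan) h mx mw =
      complete (shifted-fan y∉ fan) shifted-hole (shifted-miss (distinct h) mx)
               (shifted-miss (λ { refl → y∉ (fan-last∈ fan) }) mw)
      where open Shift h p m

    -- x y is uncoloured, x y₁ has colour d, and both y and the last vertex w
    -- lack d.  Without x y₁, the centre x lacks both d and a, so flipping the
    -- d/a-chain that starts at y₁ leaves d missing at y or at w.
    resolve-first : ∀ {c y y₁ ys w a d} → HoleAt c y → col c x y₁ ≡ just d → Miss c y d →
                    y ∉ y₁ ∷ ys → Fan c x y₁ ys w → Miss c w d → Miss c x a → Completed
    resolve-first {c} {y} {y₁} {ys} {w} {a} {d} h p my y∉ fan mw mx = result
      where
      x≢y₁ = edge-distinct c p
      c₀ = remove c x y₁ x≢y₁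
      d≢a : d ≢ a
      d≢a refl = mx y₁ p
      F = flip c₀ y₁ d≢a (remove-missʳ c x≢y₁ p)
      module F = Flip F
      c₁ = F.out

      c₁-x : Miss c₁ x d × Miss c₁ x a
      c₁-x = flip-both F (remove-missˡ c x≢y₁ p) (remove-miss c x≢y₁ mx)

      c₀-y : Miss c₀ y d
      c₀-y = remove-miss c x≢y₁ my

      add-other : ∀ {u e b} → b ≢ e → Miss c₁ u e → ∀ v → recolour c₁ x y (just b) u v ≢ just e
      add-other b≢e miss = recolour-miss-other c₁ x y _ miss (b≢e ∘ just-injective)

      y≢y₁ : y ≢ y₁
      y≢y₁ refl = y∉ (here refl)

      result : Completed
      result with F.end ≟ y
      -- `y` still lacks `d`: `x y` takes `d`, and `x y₁` takes `a`, which the flip has freed at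
      -- `y₁`.
      ... | no end≢y =
        fill (move h p c₁ F.support (proj₁ c₁-x) c₁-y)
             (add-other d≢a (proj₂ c₁-x))
             (add-other d≢a (proj₁ F.swap-x (remove-missʳ c x≢y₁ p)))
        where
        c₁-y : Miss c₁ y d
        c₁-y = proj₁ (F.rest y≢y₁ (end≢y ∘ sym)) c₀-y
      -- `y` now lacks `a`, so `x y` takes `a`. The last vertex `w` is neither end of the chain and
      -- still lacks `d`, as does `x`, so the fan from `y₁` can be rotated.
      ... | yes end≡y = complete (fan-map kept fan)
                                 (move h p c₁ F.support (proj₂ c₁-x) c₁-y)
                                 (add-other (d≢a ∘ sym) (proj₁ c₁-x))
                                 (add-other (d≢a ∘ sym) c₁-w)
        where
        c₁-y : Miss c₁ y a
        c₁-y = proj₁ (subst (Swapped c₀ c₁ d a) end≡y F.swap-end) c₀-y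

        c₁-w : Miss c₁ w d
        c₁-w = proj₁ (F.rest (λ { refl → mw x (col-sym c p) })
                             (λ w≡end → y∉ (subst (_∈ y₁ ∷ ys) (trans w≡end end≡y) (fan-last∈ fan))))
                     (remove-miss c x≢y₁ mw)

        -- The spokes after `y₁` carry neither `d`, which `x y₁` carries, nor `a`, which `x` lacks;
        -- hence the flip does not disturb the fan.
        kept : ∀ {v e} → v ∈ ys → col c x v ≡ just e →
               recolour c₁ x y (just a) x v ≡ just e
               × (∀ {u} → u ∈ y₁ ∷ ys → Miss c u e →
                  ∀ t → recolour c₁ x y (just a) u t ≢ just e)
        kept {v} {e} v∈ q =
            trans (recolour-off c₁ x y (just a) (spoke-≢ (distinct h) (λ { refl → y∉ (there v∈) })))
                  (F.keep e≢d e≢a (trans (recolour-off c x y₁ nothing (spoke-≢ x≢y₁ v≢y₁)) q))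
          , λ _ miss → recolour-miss-other c₁ x y (just a)
              (λ t r → remove-miss c x≢y₁ miss t (F.keep⁻ e≢d e≢a r))
              (λ { refl → e≢a refl })
          where
          v≢y₁ : v ≢ y₁
          v≢y₁ refl = fan-head∉ fan v∈
          e≢d : e ≢ d
          e≢d refl = v≢y₁ (inj c q p)
          e≢a : e ≢ a
          e≢a refl = mx v q

    -- Rotation brings the hole to the predecessor of `y′` in the fan; by the fan condition that
    -- vertex lacks the colour of `x y′`, which is `d`.
    resolve : ∀ {c y ys w y′ a d} → Fan c x y ys w → HoleAt c y → y′ ∈ ys →
              col c x y′ ≡ just d → Miss c w d → Miss c x a → Completed
    resolve {c} {y} {y′ = y′} (step {y′ = y₁} p m y∉ fan) h y′∈ q mw mx with y′ ≟ y₁ | y′∈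
    ... | yes refl | _ = resolve-first h q (subst (Miss c y) (just-injective (trans (sym p) q)) m)
                                       y∉ fan mw mx
    ... | no y′≢y₁ | here e = contradiction e y′≢y₁
    ... | no y′≢y₁ | there y′∈ys =
      resolve (shifted-fan y∉ fan) shifted-hole y′∈ys
              (trans (shifted-col (λ { refl → y∉ (there y′∈ys) }) y′≢y₁) q)
              (shifted-miss (λ { refl → y∉ (fan-last∈ fan) }) mw)
              (shifted-miss (distinct h) mx)
      where open Shift h p m

    -- W contains the vertices outside the fan.
    extend : ∀ m (W : Subset n) → ∣ W ∣ < m → ∀ {c y ys w a} → Fan c x y ys w → HoleAt c y →
             (∀ v → v ∈ₛ W ⊎ v ∈ y ∷ ys) → Miss c x a →
             (∀ v → is-just (col c x v) ≡ true → ∃ (Miss c v)) → ∃ (Miss c w) → Completed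
    extend (suc m) W (s≤s ∣W∣≤m) {c} {y} {ys} fan h cover mx free (d , mw) with present? c x d
    ... | inj₂ mx′ = complete fan h mx′ mw
    ... | inj₁ (y′ , p) with any∈? (y′ ≟_) ys
    ...   | yes y′∈ = resolve fan h y′∈ p mw mx
    ...   | no y′∉ = extend m (W - y′) (<-≤-trans (x∈p⇒∣p-x∣<∣p∣ y′∈W) ∣W∣≤m)
                            (fan-snoc fan p mw y′∉y∷ys) h cover′ mx free (free y′ (cong is-just p))
      where
      y′∉y∷ys : y′ ∉ y ∷ ys
      y′∉y∷ys (here e) = hole-≢ h p e
      y′∉y∷ys (there y′∈) = y′∉ y′∈

      y′∈W : y′ ∈ₛ W
      y′∈W with cover y′
      ... | inj₁ ∈W = ∈W
      ... | inj₂ ∈ys = contradiction ∈ys y′∉y∷ys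

      cover′ : ∀ v → v ∈ₛ W - y′ ⊎ v ∈ y ∷ ys ++ [ y′ ]
      cover′ v with v ≟ y′ | cover v
      ... | yes refl | _ = inj₂ (∈-++⁺ʳ (y ∷ ys) (here refl))
      ... | no v≢y′ | inj₁ ∈W = inj₁ (x∈p∧x≢y⇒x∈p-y ∈W v≢y′)
      ... | no _ | inj₂ ∈ys = inj₂ (∈-++⁺ˡ ∈ys)

  -- A fan starts at `y` and grows only along coloured edges at `x`, so colours have to be missing
  -- only at `x`, at `y` and at these neighbours. A vertex elsewhere may see all `k` colours.
  insert : ∀ (c : PartialColouring n k) {x y} → x ≢ y → col c x y ≡ nothing →
           ∃ (Miss c x) → (∀ v → v ≡ y ⊎ is-just (col c x v) ≡ true → ∃ (Miss c v)) →
           Σ (PartialColouring n k) λ c′ →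
             ∀ u v → is-just (col c′ u v) ≡ does (sameEdge? x y u v) ∨ is-just (col c u v)
  insert c {x} {y} x≢y p (_ , mx) free =
    extend s x (suc ∣ ⊤ {n} ∣) ⊤ (s≤s ≤-refl) stop hole-xy (λ _ → inj₁ ∈⊤) mx
           (λ v → free v ∘ inj₂) (free y (inj₁ refl))
    where
    s : Fin n → Fin n → Bool
    s u v = does (sameEdge? x y u v) ∨ is-just (col c u v)

    hole-xy : HoleAt s x c y
    hole-xy = record
      { distinct = x≢y
      ; hole = p
      ; want = λ {u} {v} e → cong (_∨ _) (dec-true (sameEdge? x y u v) e)
      ; off = λ {u} {v} ¬e → sym (cong (_∨ _) (dec-false (sameEdge? x y u v) ¬e))
      }

-- Missing colours by counting.

image-≤ : ∀ {k n} (S : Subset n) (f : Fin k → Fin n) →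
          (∀ {a b} → f a ≡ f b → a ≡ b) → (∀ a → f a ∈ₛ S) → k ≤ ∣ S ∣
image-≤ {zero} S f f-inj f∈ = z≤n
image-≤ {suc k} S f f-inj f∈ =
  ≤-<-trans (image-≤ (S - f zero) (f ∘ suc) (suc-injective ∘ f-inj)
               λ a → x∈p∧x≢y⇒x∈p-y (f∈ (suc a)) (0≢1+n ∘ sym ∘ f-inj))
            (x∈p⇒∣p-x∣<∣p∣ (f∈ zero))

module _ {n k : ℕ} where

  miss? : ∀ (c : PartialColouring n k) u a → Dec (Miss c u a)
  miss? c u a with present? c u a
  ... | inj₁ (v , p) = no λ miss → miss v p
  ... | inj₂ miss = yes miss

  -- Pigeonhole: if every colour occurred at `u`, the map from a colour to the neighbour it leads to
  -- would inject the `k` colours into `S`.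
  missing : ∀ (c : PartialColouring n k) u (S : Subset n) →
            (∀ {v a} → col c u v ≡ just a → v ∈ₛ S) → ∣ S ∣ < k → ∃ (Miss c u)
  missing c u S inS ∣S∣<k with any? (miss? c u)
  ... | yes m = m
  ... | no ¬m = contradiction (image-≤ S (proj₁ ∘ partner) partner-inj (inS ∘ proj₂ ∘ partner))
                              (<⇒≱ ∣S∣<k)
    where
    partner : ∀ a → ∃ λ v → col c u v ≡ just a
    partner a with present? c u a
    ... | inj₁ p = p
    ... | inj₂ miss = contradiction (a , miss) ¬m

    partner-inj : ∀ {a b} → proj₁ (partner a) ≡ proj₁ (partner b) → a ≡ b
    partner-inj {a} {b} e = just-injective
      (trans (sym (proj₂ (partner a))) (trans (cong (col c u) e) (proj₂ (partner b))))

  empty : PartialColouring n k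
  empty = record
    { col = λ _ _ → nothing ; symm = λ _ _ → refl ; loopless = λ _ → refl ; inj = λ () }

  Within : (Fin n → Fin n → Set) → PartialColouring n k → Set
  Within R c = ∀ {u v} → is-just (col c u v) ≡ true → R u v

-- Processing all pairs of vertices: colouring a graph, maximal matchings.

sweep : {S X : Set} (Todo : X → Set) (Done : S → X → Set) →
        (∀ s x → Σ S λ s′ → (Todo x → Done s′ x) × (∀ y → Done s y → Done s′ y)) →
        ∀ s xs → Σ S λ s′ → (∀ {x} → x ∈ xs → Todo x → Done s′ x) × (∀ y → Done s y → Done s′ y)
sweep Todo Done next s [] = s , (λ ()) , λ _ d → d
sweep Todo Done next s (x ∷ xs) with next s x
... | s₁ , done , mono with sweep Todo Done next s₁ xs
... | s₂ , dones , mono′ =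
  s₂ , (λ { (here refl) t → mono′ x (done t) ; (there x∈) → dones x∈ })
     , λ y d → mono′ y (mono y d)

pairs : ∀ n → List (Fin n × Fin n)
pairs n = cartesianProduct (allFin n) (allFin n)

∈-pairs : ∀ {n} (u v : Fin n) → (u , v) ∈ pairs n
∈-pairs u v = ∈-cartesianProduct⁺ (∈-allFin u) (∈-allFin v)

Extension : ∀ {n k} (R Q : Fin n → Fin n → Set) → PartialColouring n k → Set
Extension {n} {k} R Q c = Σ (PartialColouring n k) λ c′ → Within R c′
  × (∀ {u v} → Q u v → is-just (col c′ u v) ≡ true)
  × (∀ {u v} → is-just (col c u v) ≡ true → is-just (col c′ u v) ≡ true)

-- `R` is the graph that may carry colours, including those of an earlier phase, which insertions
-- may change but not erase. `Q` holds the pairs to be coloured, oriented so that the first vertex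
-- is the centre of the fan.
colour-all : ∀ {n k} (R Q : Fin n → Fin n → Set) → (∀ u v → Dec (Q u v)) →
  (∀ {u v} → R u v → R v u) → (∀ {v} → ¬ R v v) → (∀ {u v} → Q u v → R u v) →
  (∀ (c : PartialColouring n k) → Within R c → ∀ {u v} → Q u v → col c u v ≡ nothing →
     ∃ (Miss c u) × (∀ w → R u w → ∃ (Miss c w))) →
  ∀ (c : PartialColouring n k) → Within R c → Extension R Q c
colour-all {n} {k} R Q Q? R-sym R-irrefl Q⊆R free c within =
  let (c′ , within′) , done , mono = sweep Todo Done next (c , λ {u} {v} → within {u} {v}) (pairs n)
  in c′ , within′ , (λ {u} {v} → done (∈-pairs u v)) , λ {u} {v} → mono (u , v)
  where
  State = Σ (PartialColouring n k) (Within R)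

  Todo : Fin n × Fin n → Set
  Todo (u , v) = Q u v

  Done : State → Fin n × Fin n → Set
  Done (c , _) (u , v) = is-just (col c u v) ≡ true

  next : ∀ s x → Σ State λ s′ → (Todo x → Done s′ x) × (∀ y → Done s y → Done s′ y)
  next (c , within) (u , v) with Q? u v | is-just (col c u v) in eq
  ... | no ¬q | _ = (c , within) , (λ q → contradiction q ¬q) , λ _ d → d
  ... | yes q | true = (c , within) , (λ _ → eq) , λ _ d → d
  ... | yes q | false =
    (c′ , λ {_} {_} → within′) , (λ _ → done)
    , λ (s , t) d → trans (supp s t) (trans (cong (_ ∨_) d) (∨-zeroʳ _))
    where
    uncoloured = ¬is-just⇒≡nothing eq
    frees = free c within q uncoloured
    inserted = insert c (λ { refl → R-irrefl (Q⊆R q) }) uncoloured (proj₁ frees)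
      λ { _ (inj₁ refl) → proj₂ frees v (Q⊆R q) ; w (inj₂ p) → proj₂ frees w (within p) }
    c′ = proj₁ inserted
    supp = proj₂ inserted

    within′ : Within R c′
    within′ {s} {t} p with sameEdge? u v s t in e
    ... | yes (inj₁ (refl , refl)) = Q⊆R q
    ... | yes (inj₂ (refl , refl)) = R-sym (Q⊆R q)
    ... | no _ = within (trans (sym (trans (supp s t) (cong (λ d → does d ∨ _) e))) p)

    done : is-just (col c′ u v) ≡ true
    done = trans (supp u v) (cong (_∨ _) (dec-true (sameEdge? u v u v) (inj₁ (refl , refl))))

-- A matching is a partial colouring with one colour, and `Miss M v zero` says that `v` is
-- unmatched.
MaximalMatching : ∀ {n} → (Fin n → Fin n → Set) → Set
MaximalMatching {n} H = Σ (PartialColouring n 1) λ M → Within H M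
  × (∀ {u v} → H u v → Miss M u zero → ¬ Miss M v zero)

maximal-matching : ∀ {n} (H : Fin n → Fin n → Set) → (∀ u v → Dec (H u v)) →
  (∀ {u v} → H u v → H v u) → (∀ {v} → ¬ H v v) → MaximalMatching H
maximal-matching {n} H H? H-sym H-irrefl =
  let (M , within) , done , _ = sweep Todo Done next (empty , λ ()) (pairs n)
  in M , within , λ {u} {v} h mu mv →
       [ (λ (w , p) → mu w p) , (λ (w , p) → mv w p) ]′ (done (∈-pairs u v) h)
  where
  State = Σ (PartialColouring n 1) (Within H)

  Todo : Fin n × Fin n → Set
  Todo (u , v) = H u v

  Matched : PartialColouring n 1 → Fin n → Set
  Matched M v = ∃ λ w → col M v w ≡ just zero

  Done : State → Fin n × Fin n → Set
  Done (M , _) (u , v) = Matched M u ⊎ Matched M v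

  next : ∀ s x → Σ State λ s′ → (Todo x → Done s′ x) × (∀ y → Done s y → Done s′ y)
  next (M , within) (u , v) with H? u v | present? M u zero | present? M v zero
  ... | no ¬h | _ | _ = (M , within) , (λ h → contradiction h ¬h) , λ _ d → d
  ... | yes _ | inj₁ p | _ = (M , within) , (λ _ → inj₁ p) , λ _ d → d
  ... | yes _ | inj₂ _ | inj₁ p = (M , within) , (λ _ → inj₂ p) , λ _ d → d
  ... | yes h | inj₂ mu | inj₂ mv =
    (M′ , λ {_} {_} → within′)
    , (λ _ → inj₁ (v , recolour-on M u v (just zero) (inj₁ (refl , refl))))
    , λ _ → Sum.map mono mono
    where
    M′ = add M u v zero (λ { refl → H-irrefl h }) mu mv

    within′ : Within H M′
    within′ {s} {t} p with sameEdge? u v s t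
    ... | yes (inj₁ (refl , refl)) = h
    ... | yes (inj₂ (refl , refl)) = H-sym h
    ... | no _ = within p

    mono : ∀ {w} → Matched M w → Matched M′ w
    mono {w} (t , p) = t , joined
      where
      joined : col M′ w t ≡ just zero
      joined with sameEdge? u v w t
      ... | yes _ = refl
      ... | no _ = p

-- Fournier's refinement: one party's graph split into a coloured part and a matching.

degree≤maxDegree : ∀ {n} (G : Graph n) v → degree G v ≤ maxDegree G
degree≤maxDegree {n} G v =
  All.lookup (map⁻ (xs≤max 0 (map (degree G) (allFin n)))) (∈-allFin v)

-- The edges left uncoloured by main get a colour of the other party.
record Split {n} (E : Graph n) (Δ : ℕ) : Set where
  field
    main           : PartialColouring n Δ
    spare-full     : ∀ {u v} → Adj E u v → col main u v ≡ nothing → Δ ≤ degree E u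
    spare-matching : ∀ {u v w} → Adj E u v → Adj E u w →
                     col main u v ≡ nothing → col main u w ≡ nothing → v ≡ w

-- Edges at High vertices are inserted last, with the High end as the centre of
-- the fan: High vertices being independent, all its neighbours lack a colour.
split : ∀ {n Δ} (E : Graph n) → maxDegree E ≤ Δ → Split E Δ
split {n} {Δ} E maxDegree≤Δ = from-matching (maximal-matching H
    (λ u v → (v ∈? lookup (nbrs E) u) ×-dec (Δ ≤? degree E u) ×-dec (Δ ≤? degree E v))
    (λ (e , fu , fv) → adj-sym E _ _ e , fv , fu) (λ (e , _) → adj-irrefl E _ e))
  where
  H : Fin n → Fin n → Set
  H u v = Adj E u v × Δ ≤ degree E u × Δ ≤ degree E v

  from-matching : MaximalMatching H → Split E Δ
  from-matching (M , within-M , maximal) = from-phase₁ phase₁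
    where
    same : ∀ {u v w} → is-just (col M u v) ≡ true → is-just (col M u w) ≡ true → v ≡ w
    same p q with is-just⇒≡just p | is-just⇒≡just q
    ... | zero , p′ | zero , q′ = inj M p′ q′

    G : Fin n → Fin n → Set
    G u v = Adj E u v × is-just (col M u v) ≡ false

    G? : ∀ u v → Dec (G u v)
    G? u v = (v ∈? lookup (nbrs E) u) ×-dec (is-just (col M u v) ≟ᵇ false)

    G-sym : ∀ {u v} → G u v → G v u
    G-sym (e , p) = adj-sym E _ _ e , trans (cong is-just (symm M _ _)) p

    -- These are the vertices of degree `Δ` in `G`: a matched vertex loses an edge.
    High : Fin n → Set
    High v = Δ ≤ degree E v × Miss M v zero

    High? : ∀ v → Dec (High v)
    High? v = (Δ ≤? degree E v) ×-dec miss? M v zero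

    High-independent : ∀ {u v} → G u v → High u → ¬ High v
    High-independent (e , _) (fu , mu) (fv , mv) = maximal (e , fu , fv) mu mv

    degree≤Δ : ∀ v → degree E v ≤ Δ
    degree≤Δ v = ≤-trans (degree≤maxDegree E v) maxDegree≤Δ

    -- The uncoloured edge leaves at most `Δ - 1` neighbours for the colours at `u`.
    missing-but : ∀ (c : PartialColouring n Δ) → Within G c → ∀ {u v} → Adj E u v →
                  (∀ {a} → col c u v ≢ just a) → ∃ (Miss c u)
    missing-but c within {u} {v} e uncoloured = missing c u (lookup (nbrs E) u - v)
      (λ p → x∈p∧x≢y⇒x∈p-y (proj₁ (within (cong is-just p))) λ { refl → uncoloured p })
      (<-≤-trans (x∈p⇒∣p-x∣<∣p∣ e) (degree≤Δ u))

    low-missing : ∀ (c : PartialColouring n Δ) → Within G c → ∀ {v} → ¬ High v → ∃ (Miss c v)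
    low-missing c within {v} low with Δ ≤? degree E v | present? M v zero
    ... | no ¬full | _ =
      missing c v (lookup (nbrs E) v) (λ p → proj₁ (within (cong is-just p))) (≰⇒> ¬full)
    ... | yes full | inj₂ miss = contradiction (full , miss) low
    -- The matching edge `v w` lies outside `G`, so it carries no colour.
    ... | yes full | inj₁ (w , p) = missing-but c within (proj₁ (within-M (cong is-just p)))
      λ q → contradiction (trans (sym (cong is-just p)) (proj₂ (within (cong is-just q)))) λ ()

    Low : Fin n → Fin n → Set
    Low u v = G u v × ¬ High u × ¬ High v

    -- As the colouring stays within `Low`, fans of this phase meet only vertices that are not
    -- `High`, and each of these lacks a colour.
    phase₁ : Extension Low Low (empty {k = Δ})
    phase₁ = colour-all Low Low (λ u v → G? u v ×-dec ¬? (High? u) ×-dec ¬? (High? v))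
      (λ (g , lu , lv) → G-sym g , lv , lu) (λ ((e , _) , _) → adj-irrefl E _ e) id
      (λ c within (_ , lu , _) _ → low-missing c (proj₁ ∘ within) lu
                                  , λ _ (_ , _ , lw) → low-missing c (proj₁ ∘ within) lw)
      empty (λ ())

    phase₂ : (c : PartialColouring n Δ) → Within G c → Extension G (λ u v → G u v × High u) c
    phase₂ = colour-all G (λ u v → G u v × High u) (λ u v → G? u v ×-dec High? u)
      G-sym (λ (e , _) → adj-irrefl E _ e) proj₁
      (λ c within ((e , _) , hu) p → missing-but c within e (λ q → just≢nothing q p)
                                    , λ _ g → low-missing c within (High-independent g hu))

    from-colouring : (c : PartialColouring n Δ) →
                     (∀ {u v} → G u v → is-just (col c u v) ≡ true) → Split E Δ
    from-colouring c coloured = record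
      { main = c ; spare-full = λ e p → proj₁ (proj₂ (within-M (spare e p)))
      ; spare-matching = λ e f p q → same (spare e p) (spare f q) }
      where
      spare : ∀ {u v} → Adj E u v → col c u v ≡ nothing → is-just (col M u v) ≡ true
      spare {u} {v} e p with is-just (col M u v) in eq
      ... | true = refl
      ... | false = contradiction (trans (sym (coloured (e , eq))) (cong is-just p)) λ ()

    from-phase₁ : Extension Low Low (empty {k = Δ}) → Split E Δ
    from-phase₁ (c₁ , within₁ , done₁ , _) with phase₂ c₁ (λ p → proj₁ (within₁ p))
    ... | c₂ , _ , done₂ , kept = from-colouring c₂ coloured
      where
      coloured : ∀ {u v} → G u v → is-just (col c₂ u v) ≡ true
      coloured {u} {v} g with High? u | High? v
      ... | yes hu | _ = done₂ (g , hu)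
      ... | no _ | yes hv = trans (cong is-just (symm c₂ u v)) (done₂ (G-sym g , hv))
      ... | no lu | no lv = kept (done₁ (g , lu , lv))

-- The two palettes and the combined colouring.

module _ (own other : Fin 2) where

  -- `Fin.combine` reads the palette as two blocks of `Δ` colours; `z` is the position of the
  -- borrowed colour in the block of the other party.
  paint : ∀ {Δ} → Fin Δ → Maybe (Fin Δ) → Fin (2 * Δ)
  paint z (just a) = Fin.combine own a
  paint z nothing  = Fin.combine other z

  paint-injective : own ≢ other → ∀ {Δ} {y z : Fin Δ} {m m′} → paint y m ≡ paint z m′ → m ≡ m′
  paint-injective own≢other {m = just a} {just b} e = cong just (combine-injectiveʳ own a own b e)
  paint-injective own≢other {y = y} {z} {just a} {nothing} e =
    contradiction (combine-injectiveˡ own a other z e) own≢other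
  paint-injective own≢other {y = y} {z} {nothing} {just b} e =
    contradiction (sym (combine-injectiveˡ other y own b e)) own≢other
  paint-injective own≢other {m = nothing} {nothing} e = refl

  module _ {n} (E : Graph n) {Δ} (bound : maxDegree E ≤ Δ) (S : Split E Δ) where
    open Split S

    -- The borrowed colour is the first of its block; it exists because an edge forces `Δ` to be
    -- positive.
    0<Δ : ∀ {u v} → Adj E u v → 0 < Δ
    0<Δ {u} e = ≤-trans (≤-<-trans z≤n (x∈p⇒∣p-x∣<∣p∣ e)) (≤-trans (degree≤maxDegree E u) bound)

    colouring : EdgeColoring E (2 * Δ)
    colouring .color u v e = paint (fromℕ< (0<Δ e)) (col main u v)
    colouring .agree u v e f = cong (paint (fromℕ< (0<Δ e))) (symm main u v)

    colouring-proper : own ≢ other → Proper colouring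
    colouring-proper own≢other u v w e f v≢w eq with col main u v in p | col main u w in q
    ... | m | m′ with paint-injective own≢other {m = m} {m′} eq
    ...   | refl with m
    ...     | just a  = v≢w (inj main p q)
    ...     | nothing = v≢w (spare-matching e f p q)

    colouring-own : ∀ u v (e : Adj E u v) → degree E u < Δ →
                    ∃ λ a → color colouring u v e ≡ Fin.combine own a
    colouring-own u v e degree<Δ with col main u v in p
    ... | just a  = a , refl
    ... | nothing = contradiction (spare-full e p) (<⇒≱ degree<Δ)

  algorithm : LocalAlgorithm (λ Δ → 2 * Δ)
  algorithm n Δ E bound = colouring E bound′ (split E bound′)
    where bound′ = recompute (maxDegree E ≤? Δ) bound

degree<maxDegree : ∀ {n} (H G : Graph n) → (∀ u v → Adj H u v → Adj G u v) → ∀ {u w} →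
           Adj G u w → ¬ Adj H u w → degree H u < maxDegree G
degree<maxDegree H G H⊆G {u} {w} g ¬h = <-≤-trans
  (p⊂q⇒∣p∣<∣q∣ ((λ {v} → H⊆G u v) , w , g , ¬h)) (degree≤maxDegree G u)

combine-proper : ∀ {n} {G A B : Graph n} (p : Partition G A B)
  (A≤ : maxDegree A ≤ maxDegree G) (S : Split A (maxDegree G))
  (B≤ : maxDegree B ≤ maxDegree G) (T : Split B (maxDegree G)) →
  Proper (combine p (colouring zero (suc zero) A A≤ S) (colouring (suc zero) zero B B≤ T))
combine-proper {G = G} {A} {B} p A≤ S B≤ T u v w e f =
  pick-proper (Equivalence.to (cover p u v) e) (Equivalence.to (cover p u w) f)
  where
  a = colouring zero (suc zero) A A≤ S
  b = colouring (suc zero) zero B B≤ T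

  A⊆G : ∀ u v → Adj A u v → Adj G u v
  A⊆G u v = Equivalence.from (cover p u v) ∘ inj₁

  B⊆G : ∀ u v → Adj B u v → Adj G u v
  B⊆G u v = Equivalence.from (cover p u v) ∘ inj₂

  -- Each party lacks the other's edge at `u`, so both have degree below `maxDegree G` there and
  -- keep to their own blocks.
  cross : ∀ {u v w} (e : Adj A u v) (f : Adj B u w) → color a u v e ≢ color b u w f
  cross {u} {v} {w} e f eq
    with colouring-own zero (suc zero) A A≤ S u v e
           (degree<maxDegree A G A⊆G (B⊆G u w f) λ h → disjoint p u w (h , f))
       | colouring-own (suc zero) zero B B≤ T u w f
           (degree<maxDegree B G B⊆G (A⊆G u v e) λ h → disjoint p u v (e , h))
  ... | i , p₁ | j , p₂
    with () ← combine-injectiveˡ {2} zero i (suc zero) j (trans (sym p₁) (trans eq p₂))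

  pick-proper : ∀ {u v w} x y → v ≢ w → pick p a b u v x ≢ pick p a b u w y
  pick-proper (inj₁ e) (inj₁ f) = colouring-proper zero (suc zero) A A≤ S (λ ()) _ _ _ e f
  pick-proper (inj₂ e) (inj₂ f) = colouring-proper (suc zero) zero B B≤ T (λ ()) _ _ _ e f
  pick-proper (inj₁ e) (inj₂ f) _ = cross e f
  pick-proper (inj₂ e) (inj₁ f) _ = cross f e ∘ sym

theorem3 : Σ (LocalAlgorithm (λ Δ → 2 * Δ)) λ alice →
    Σ (LocalAlgorithm (λ Δ → 2 * Δ)) λ bob →
    ∀ (n Δ : ℕ) (G A B : Graph n) (p : Partition G A B) (d : maxDegree G ≡ Δ) →
    Proper (combine p (alice n Δ A (partˡ-≤ p d)) (bob n Δ B (partʳ-≤ p d)))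
theorem3 = algorithm zero (suc zero) , algorithm (suc zero) zero , proper
  where
  proper : ∀ n Δ (G A B : Graph n) (p : Partition G A B) (d : maxDegree G ≡ Δ) →
           Proper (combine p (algorithm zero (suc zero) n Δ A (partˡ-≤ p d))
                             (algorithm (suc zero) zero n Δ B (partʳ-≤ p d)))
  proper n Δ G A B p refl = combine-proper p A≤ (split A A≤) B≤ (split B B≤)
    where
    -- The bounds are recomputed exactly as in `algorithm`, so that both colourings agree by
    -- definition with those it returns.
    A≤ = recompute (maxDegree A ≤? maxDegree G) (partˡ-≤ p refl)
    B≤ = recompute (maxDegree B ≤? maxDegree G) (partʳ-≤ p refl)
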